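{- For every integer $n\geqslant 0$ and every $r\in\{1,2\}$, $$p(n) = (-1)^{r-1} \sum_{k=r}^{n+r} S^{(r)}_{n+r,k}\, \mu(k).$$
   Context: $p(n)$ denotes the number of partitions of the non-negative integer $n$ (with $p(0)=1$). $\mu$ is the classical Möbius function on positive integers: $\mu(m)=0$ if $m$ is divisible by the square of a prime, and $\mu(m)=(-1)^s$ if $m$ is a product of $s\geqslant 0$ distinct primes. For integers $r\geqslant 1$, $k\geqslant 1$, $m\geqslant 0$, $S^{(r)}_{m,k}$ denotes the number of $k$'s in the partitions of $m$ with smallest part at least $r$, i.e. the total number of occurrences (with multiplicity) of the part $k$ summed over all partitions of $m$ all of whose parts are $\geqslant r$. -}

module Defs where

open import Data.Bool.Base using (if_then_else_)
open import Data.Empty using (⊥)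
open import Data.Integer.Base as ℤ using (ℤ; 0ℤ; -1ℤ)
open import Data.List.Base using (List; []; _∷_; _++_; map; filter; length; foldr; applyUpTo)
open import Data.List.Membership.Propositional using (_∈_)
open import Data.List.Membership.Propositional.Properties
  using (∈-++⁺ˡ; ∈-++⁺ʳ; ∈-++⁻; ∈-map⁺; ∈-map⁻; ∈-filter⁺; ∈-filter⁻)
open import Data.List.Properties using (∷-injectiveʳ)
open import Data.List.Relation.Unary.All as All using (All; []; _∷_; all?)
open import Data.List.Relation.Unary.AllPairs using (AllPairs; []; _∷_)
open import Data.List.Relation.Unary.Any using (here)
open import Data.List.Relation.Unary.Unique.Propositional using (Unique)
import Data.List.Relation.Unary.Unique.Propositional.Properties as Unique
open import Data.Nat.Base
open import Data.Nat.Divisibility using (_∣_; _∣?_; ∣⇒≤; n∣m*n; ∣-trans)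
open import Data.Nat.ListAction using (sum)
open import Data.Nat.Primality using (Prime; prime?)
open import Data.Nat.Primality.Factorisation using (factorise; factors)
open import Data.Nat.Properties
open import Data.Product.Base using (∃; _×_; _,_; proj₂)
open import Data.Sum.Base using (inj₁; inj₂)
open import Function.Bundles using (_⇔_; mk⇔)
open import Relation.Binary.PropositionalEquality using (_≡_; refl)
open import Relation.Nullary.Decidable using (Dec; does; map′; _×-dec_)

-- A partition is represented by its parts, listed in weakly decreasing order.
record IsPartition (n : ℕ) (xs : List ℕ) : Set where
  constructor isPartition
  field
    decreasing : AllPairs _≥_ xs
    positive   : All (1 ≤_) xs
    total      : sum xs ≡ n

-- All weakly decreasing lists of length at most l with entries in {1, …, b}.
decreasingLists : (l b : ℕ) → List (List ℕ)
decreasingLists zero    _       = [] ∷ []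
decreasingLists (suc l) zero    = [] ∷ []
decreasingLists (suc l) (suc b) =
  map (suc b ∷_) (decreasingLists l (suc b)) ++ decreasingLists (suc l) b

-- A partition of n has at most n parts, none of which exceeds n; see
-- ∈-partitions and partitions-unique below for correctness.
partitions : ℕ → List (List ℕ)
partitions n = filter (λ xs → sum xs ≟ n) (decreasingLists n n)

p : ℕ → ℕ
p n = length (partitions n)

multiplicity : ℕ → List ℕ → ℕ
multiplicity k xs = length (filter (k ≟_) xs)

S : (r m k : ℕ) → ℕ
S r m k = sum (map (multiplicity k) (filter (all? (r ≤?_)) (partitions m)))

PrimeSquareDivides : ℕ → Set
PrimeSquareDivides m = ∃ λ q → Prime q × (q * q) ∣ m

primeSquareDivides? : ∀ m .{{_ : NonZero m}} → Dec (PrimeSquareDivides m)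
primeSquareDivides? m = map′
  (λ (q , _ , h) → q , h)
  (λ (q , qPrime , q²∣m) → q , s≤s (∣⇒≤ (∣-trans (n∣m*n q) q²∣m)) , qPrime , q²∣m)
  (anyUpTo? (λ q → prime? q ×-dec (q * q) ∣? m) (suc m))

-- The value at 0 is a placeholder: μ is only meaningful on positive integers.
-- When no prime square divides m, the prime factors listed by factorise m are
-- distinct.
μ : ℕ → ℤ
μ zero      = 0ℤ
μ m@(suc _) =
  if does (primeSquareDivides? m)
  then 0ℤ
  else -1ℤ ℤ.^ length (factors (factorise m))

sumFromTo : (a b : ℕ) → (ℕ → ℤ) → ℤ
sumFromTo a b f = foldr ℤ._+_ 0ℤ (applyUpTo (λ i → f (a + i)) (suc b ∸ a))

syntax sumFromTo a b (λ k → e) = ∑[ k from a to b ] e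

decreasingLists-sound : ∀ l b {xs} → xs ∈ decreasingLists l b →
  AllPairs _≥_ xs × All (1 ≤_) xs × All (_≤ b) xs
decreasingLists-sound zero    b       (here refl) = [] , [] , []
decreasingLists-sound (suc l) zero    (here refl) = [] , [] , []
decreasingLists-sound (suc l) (suc b) xs∈
  with ∈-++⁻ (map (suc b ∷_) (decreasingLists l (suc b))) xs∈
... | inj₂ xs∈ʳ =
  let dec , pos , bnd = decreasingLists-sound (suc l) b xs∈ʳ
  in dec , pos , All.map m≤n⇒m≤1+n bnd
... | inj₁ xs∈ˡ with ∈-map⁻ (suc b ∷_) xs∈ˡ
... | ys , ys∈ , refl =
  let dec , pos , bnd = decreasingLists-sound l (suc b) ys∈
  in bnd ∷ dec , s≤s z≤n ∷ pos , ≤-refl ∷ bnd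

decreasingLists-complete : ∀ l b {xs} → AllPairs _≥_ xs → All (1 ≤_) xs →
  All (_≤ b) xs → length xs ≤ l → xs ∈ decreasingLists l b
decreasingLists-complete zero    b       {[]}    _ _ _ _ = here refl
decreasingLists-complete (suc l) zero    {[]}    _ _ _ _ = here refl
decreasingLists-complete (suc l) zero    {_ ∷ _} _ (s≤s _ ∷ _) (() ∷ _) _
decreasingLists-complete (suc l) (suc b) {[]}    _ _ _ _ =
  ∈-++⁺ʳ (map (suc b ∷_) (decreasingLists l (suc b)))
    (decreasingLists-complete (suc l) b [] [] [] z≤n)
decreasingLists-complete (suc l) (suc b) {x ∷ xs} (x≥ ∷ dec) (x>0 ∷ pos) (x≤ ∷ bnd) (s≤s len)
  with m≤n⇒m<n∨m≡n x≤
... | inj₂ refl = ∈-++⁺ˡ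
  (∈-map⁺ (suc b ∷_) (decreasingLists-complete l (suc b) dec pos bnd len))
... | inj₁ (s≤s x≤b) = ∈-++⁺ʳ (map (suc b ∷_) (decreasingLists l (suc b)))
  (decreasingLists-complete (suc l) b (x≥ ∷ dec) (x>0 ∷ pos)
    (x≤b ∷ All.map (λ y≤x → ≤-trans y≤x x≤b) x≥) (s≤s len))

decreasingLists-unique : ∀ l b → Unique (decreasingLists l b)
decreasingLists-unique zero    b       = [] ∷ []
decreasingLists-unique (suc l) zero    = [] ∷ []
decreasingLists-unique (suc l) (suc b) = Unique.++⁺
  (Unique.map⁺ ∷-injectiveʳ (decreasingLists-unique l (suc b)))
  (decreasingLists-unique (suc l) b)
  disjoint
  where
  disjoint : ∀ {xs} → xs ∈ map (suc b ∷_) (decreasingLists l (suc b)) ×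
                      xs ∈ decreasingLists (suc l) b → ⊥
  disjoint (∈ˡ , ∈ʳ) with ∈-map⁻ (suc b ∷_) ∈ˡ
  ... | _ , _ , refl =
    1+n≰n (All.head (proj₂ (proj₂ (decreasingLists-sound (suc l) b ∈ʳ))))

all≤sum : ∀ xs → All (_≤ sum xs) xs
all≤sum []       = []
all≤sum (x ∷ xs) = m≤m+n x (sum xs) ∷ All.map (λ y≤ → m≤n⇒m≤o+n x y≤) (all≤sum xs)

length≤sum : ∀ {xs} → All (1 ≤_) xs → length xs ≤ sum xs
length≤sum []          = z≤n
length≤sum (x>0 ∷ pos) = +-mono-≤ x>0 (length≤sum pos)

∈-partitions : ∀ {n xs} → xs ∈ partitions n ⇔ IsPartition n xs
∈-partitions {n} {xs} = mk⇔ to from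
  where
  to : xs ∈ partitions n → IsPartition n xs
  to xs∈ =
    let xs∈′ , total = ∈-filter⁻ (λ ys → sum ys ≟ n) {xs = decreasingLists n n} xs∈
        dec , pos , _ = decreasingLists-sound n n xs∈′
    in isPartition dec pos total

  from : IsPartition n xs → xs ∈ partitions n
  from (isPartition dec pos refl) = ∈-filter⁺ (λ ys → sum ys ≟ n)
    (decreasingLists-complete n n dec pos (all≤sum xs) (length≤sum pos)) refl

partitions-unique : ∀ n → Unique (partitions n)
partitions-unique n = Unique.filter⁺ (λ xs → sum xs ≟ n) (decreasingLists-unique n n)

{-# OPTIONS --safe #-}

module Submission where

-- Write p≥ r m for the number of partitions of m into parts at least r. Removing one part k
-- shows that, for k ≥ r, S r m k is the sum of p≥ r (m − d) over the multiples d of k with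
-- 1 ≤ d ≤ m. If this sum is weighted by μ k and taken over all k ≥ 1, then the coefficient of
-- p≥ r (m − d) is the sum of μ over the divisors of d, so that only d = 1 survives and the
-- total is p≥ r (m − 1). For r = 1 this is p n. For r = 2 the range of summation leaves out
-- k = 1, whose term is p≥ 2 0 + ⋯ + p≥ 2 (n + 1) = p (n + 1) = p≥ 2 (n + 1) + p n, and the
-- remaining terms add up to − p n.

open import Defs
open import Algebra.Properties.CommutativeSemigroup using (x∙yz≈y∙xz; interchange)
open import Data.Bool.Base using (if_then_else_)
open import Data.Integer.Base as ℤ using (ℤ; 0ℤ; 1ℤ; -1ℤ)
import Data.Integer.Properties as ℤ
open import Data.List.Base
  using (List; []; _∷_; _++_; map; filter; length; foldr; applyUpTo)
open import Data.List.Membership.Propositional using (_∈_; _∉_)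
open import Data.List.Membership.Propositional.Properties
  using (∈-++⁺ˡ; ∈-++⁺ʳ; ∈-++⁻; ∈-map⁺; ∈-map⁻; ∈-filter⁺; ∈-filter⁻; ∈-∃++)
open import Data.List.Membership.Propositional.Properties.WithK using (unique∧set⇒bag)
open import Data.List.Properties
  using ( ∷-injectiveˡ; ∷-injectiveʳ; filter-accept; filter-all; filter-none
        ; length-++; length-map; map-++; map-∘; map-cong)
open import Data.List.Relation.Binary.BagAndSetEquality using (∼bag⇒↭)
open import Data.List.Relation.Binary.Permutation.Propositional
  using (_↭_; prep; ↭-sym; ↭-trans; ↭⇒↭ₛ)
open import Data.List.Relation.Binary.Permutation.Propositional.Properties
  using (All-resp-↭; ∈-resp-↭; filter-↭; map⁺; shift; ↭-length)
open import Data.List.Relation.Binary.Pointwise using (Pointwise-≡⇒≡)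
open import Data.List.Relation.Unary.All as All using (All; []; _∷_; all?)
open import Data.List.Relation.Unary.All.Properties using (¬Any⇒All¬)
open import Data.List.Relation.Unary.AllPairs using (AllPairs)
open import Data.List.Relation.Unary.Any using (here; there)
import Data.List.Relation.Unary.Sorted.TotalOrder.Properties as Sorted
open import Data.List.Relation.Unary.Unique.Propositional using (Unique)
import Data.List.Relation.Unary.Unique.Propositional.Properties as Unique
import Data.List.Sort.InsertionSort.Base as InsertionSort
import Data.List.Sort.InsertionSort.Properties as InsertionSortProperties
open import Data.Nat.Base
open import Data.Nat.Coprimality using (Coprime; coprime-divisor)
open import Data.Nat.Divisibility
open import Data.Nat.Induction using (<-rec)
open import Data.Nat.ListAction using (product; sum)
open import Data.Nat.ListAction.Properties using (sum-++; sum-↭)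
open import Data.Nat.Primality using (Prime; euclidsLemma; prime⇒irreducible; prime⇒nonZero; ¬prime[1])
open import Data.Nat.Primality.Factorisation using (PrimeFactorisation; factorise; factorisationUnique; factors)
open import Data.Nat.Properties
open import Data.Product.Base using (∃; _×_; _,_; proj₁; proj₂)
open import Data.Sum.Base using (_⊎_; inj₁; inj₂; [_,_]′)
open import Function.Base using (_∘_; case_of_)
open import Function.Bundles using (_⇔_; mk⇔; module Equivalence)
open import Relation.Binary.Bundles using (DecTotalOrder)
import Relation.Binary.Construct.Flip.EqAndOrd as Flip
open import Relation.Binary.PropositionalEquality
open import Relation.Nullary using (Dec; yes; no; ¬_; ¬?; contradiction)
open import Relation.Nullary.Decidable using (does; dec-true; dec-false)

open import Data.List.Membership.DecPropositional _≟_ using (_∈?_)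
open import Algebra.Properties.AbelianGroup ℤ.+-0-abelianGroup using (inverseʳ-unique; identityʳ-unique)
open Equivalence using (to; from)
open ≡-Reasoning

private
  variable
    A B : Set
    k m n r : ℕ
    xs ys : List ℕ

-- Finite integer sums and conditional terms.

+-congˡ : ∀ i {j k} → j ≡ k → i ℤ.+ j ≡ i ℤ.+ k
+-congˡ i = cong (λ j → i ℤ.+ j)

-- Folded over `applyUpTo` exactly as in `sumFromTo`, so that the sum in the theorem reduces to an
-- instance of this one.
∑< : ℕ → (ℕ → ℤ) → ℤ
∑< n f = foldr ℤ._+_ 0ℤ (applyUpTo f n)

∑<-cong : ∀ n {f g} → (∀ i → i < n → f i ≡ g i) → ∑< n f ≡ ∑< n g
∑<-cong zero    h = refl
∑<-cong (suc n) h = cong₂ ℤ._+_ (h 0 z<s) (∑<-cong n (λ i i<n → h (suc i) (s<s i<n)))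

∑<-zero : ∀ n {f} → (∀ i → i < n → f i ≡ 0ℤ) → ∑< n f ≡ 0ℤ
∑<-zero zero    h = refl
∑<-zero (suc n) h = cong₂ ℤ._+_ (h 0 z<s) (∑<-zero n (λ i i<n → h (suc i) (s<s i<n)))

∑<-distrib-+ : ∀ n f g → ∑< n (λ i → f i ℤ.+ g i) ≡ ∑< n f ℤ.+ ∑< n g
∑<-distrib-+ zero    f g = refl
∑<-distrib-+ (suc n) f g = begin
  (f 0 ℤ.+ g 0) ℤ.+ ∑< n (λ i → f (suc i) ℤ.+ g (suc i))
    ≡⟨ +-congˡ (f 0 ℤ.+ g 0) (∑<-distrib-+ n (f ∘ suc) (g ∘ suc)) ⟩
  (f 0 ℤ.+ g 0) ℤ.+ (∑< n (f ∘ suc) ℤ.+ ∑< n (g ∘ suc))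
    ≡⟨ interchange ℤ.+-commutativeSemigroup (f 0) (g 0) (∑< n (f ∘ suc)) (∑< n (g ∘ suc)) ⟩
  (f 0 ℤ.+ ∑< n (f ∘ suc)) ℤ.+ (g 0 ℤ.+ ∑< n (g ∘ suc)) ∎

*-distribˡ-∑< : ∀ n c f → c ℤ.* ∑< n f ≡ ∑< n (λ i → c ℤ.* f i)
*-distribˡ-∑< zero    c f = ℤ.*-zeroʳ c
*-distribˡ-∑< (suc n) c f = trans (ℤ.*-distribˡ-+ c (f 0) (∑< n (f ∘ suc)))
  (+-congˡ (c ℤ.* f 0) (*-distribˡ-∑< n c (f ∘ suc)))

*-distribʳ-∑< : ∀ n c f → ∑< n f ℤ.* c ≡ ∑< n (λ i → f i ℤ.* c)
*-distribʳ-∑< n c f = begin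
  ∑< n f ℤ.* c           ≡⟨ ℤ.*-comm (∑< n f) c ⟩
  c ℤ.* ∑< n f           ≡⟨ *-distribˡ-∑< n c f ⟩
  ∑< n (λ i → c ℤ.* f i) ≡⟨ ∑<-cong n (λ i _ → ℤ.*-comm c (f i)) ⟩
  ∑< n (λ i → f i ℤ.* c) ∎

∑<-split : ∀ m n f → ∑< (m + n) f ≡ ∑< m f ℤ.+ ∑< n (λ i → f (m + i))
∑<-split zero    n f = sym (ℤ.+-identityˡ _)
∑<-split (suc m) n f = trans (+-congˡ (f 0) (∑<-split m n (f ∘ suc)))
  (sym (ℤ.+-assoc (f 0) (∑< m (f ∘ suc)) (∑< n (λ i → f (suc m + i)))))

∑<-comm : ∀ m n (f : ℕ → ℕ → ℤ) → ∑< m (λ i → ∑< n (f i)) ≡ ∑< n (λ j → ∑< m (λ i → f i j))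
∑<-comm zero    n f = sym (∑<-zero n (λ _ _ → refl))
∑<-comm (suc m) n f = trans (+-congˡ (∑< n (f 0)) (∑<-comm m n (f ∘ suc)))
  (sym (∑<-distrib-+ n (f 0) (λ j → ∑< m (λ i → f (suc i) j))))

∑<-extend : ∀ {m n} → m ≤ n → ∀ f → (∀ i → m ≤ i → f i ≡ 0ℤ) → ∑< n f ≡ ∑< m f
∑<-extend {m} {n} m≤n f h = begin
  ∑< n f                                       ≡⟨ cong (λ l → ∑< l f) (m+[n∸m]≡n m≤n) ⟨
  ∑< (m + (n ∸ m)) f                           ≡⟨ ∑<-split m (n ∸ m) f ⟩
  ∑< m f ℤ.+ ∑< (n ∸ m) (λ i → f (m + i))      ≡⟨ +-congˡ (∑< m f) (∑<-zero (n ∸ m) (λ i _ → h (m + i) (m≤m+n m i))) ⟩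
  ∑< m f ℤ.+ 0ℤ                                ≡⟨ ℤ.+-identityʳ _ ⟩
  ∑< m f                                       ∎

∑<-head : ∀ n f → (∀ i → i < n → f (suc i) ≡ 0ℤ) → ∑< (suc n) f ≡ f 0
∑<-head n f h = trans (+-congˡ (f 0) (∑<-zero n h)) (ℤ.+-identityʳ (f 0))

∑<-last : ∀ n f → (∀ i → i < n → f i ≡ 0ℤ) → ∑< (suc n) f ≡ f n
∑<-last zero    f h = ℤ.+-identityʳ (f 0)
∑<-last (suc n) f h = trans (cong₂ ℤ._+_ (h 0 z<s) (∑<-last n (f ∘ suc) (λ i i<n → h (suc i) (s<s i<n))))
  (ℤ.+-identityˡ (f (suc n)))

-- Sums over divisors or multiples run over a full range with the unwanted terms set to 0. Nested
-- sums of this kind can then be exchanged without adjusting any bounds.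
when : Dec A → ℤ → ℤ
when a? x = if does a? then x else 0ℤ

when-true : (a? : Dec A) {x : ℤ} → A → when a? x ≡ x
when-true a? {x} a = cong (if_then x else 0ℤ) (dec-true a? a)

when-false : (a? : Dec A) {x : ℤ} → ¬ A → when a? x ≡ 0ℤ
when-false a? {x} ¬a = cong (if_then x else 0ℤ) (dec-false a? ¬a)

when-zero : (a? : Dec A) → when a? 0ℤ ≡ 0ℤ
when-zero (yes _) = refl
when-zero (no  _) = refl

when-cong : (a? : Dec A) (b? : Dec B) (x : ℤ) → (A → B) → (B → A) → when a? x ≡ when b? x
when-cong (yes a) b? x f g = sym (when-true b? (f a))
when-cong (no ¬a) b? x f g = sym (when-false b? (¬a ∘ g))

when-+-¬ : (a? : Dec A) (x : ℤ) → x ≡ when a? x ℤ.+ when (¬? a?) x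
when-+-¬ (yes _) x = sym (ℤ.+-identityʳ x)
when-+-¬ (no  _) x = sym (ℤ.+-identityˡ x)

when-* : (a? : Dec A) (x y : ℤ) → when a? x ℤ.* y ≡ x ℤ.* when a? y
when-* (yes _) x y = refl
when-* (no  _) x y = sym (ℤ.*-zeroʳ x)

-- Cut the range into `n` blocks of length `q`: the only multiple of `q` in each block is its first
-- index.
∑<-multiples : ∀ q .{{_ : NonZero q}} n (f : ℕ → ℤ) →
  ∑< (n * q) (λ k → when (q ∣? k) (f k)) ≡ ∑< n (λ k → f (k * q))
∑<-multiples q@(suc q-1) zero    f = refl
∑<-multiples q@(suc q-1) (suc n) f = begin
  ∑< (q + n * q) (λ k → when (q ∣? k) (f k))
    ≡⟨ ∑<-split q (n * q) (λ k → when (q ∣? k) (f k)) ⟩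
  ∑< q (λ k → when (q ∣? k) (f k)) ℤ.+ ∑< (n * q) (λ k → when (q ∣? q + k) (f (q + k)))
    ≡⟨ cong₂ ℤ._+_
         (trans (∑<-head q-1 (λ k → when (q ∣? k) (f k)) (λ i i<q-1 → when-false (q ∣? suc i) (>⇒∤ (s<s i<q-1))))
                (when-true (q ∣? 0) (q ∣0)))
         (trans (∑<-cong (n * q) (λ k _ → when-cong (q ∣? q + k) (q ∣? k) _
                  (λ h → ∣m+n∣m⇒∣n h ∣-refl) (∣m∣n⇒∣m+n ∣-refl)))
                (∑<-multiples q n (λ k → f (q + k)))) ⟩
  f 0 ℤ.+ ∑< n (λ k → f (q + k * q)) ∎

-- Values of the Möbius function and its sums over divisors.

μ-nonsquarefree : ∀ m → PrimeSquareDivides m → μ m ≡ 0ℤ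
μ-nonsquarefree zero      _ = refl
μ-nonsquarefree m@(suc _) h rewrite dec-true (primeSquareDivides? m) h = refl

μ-squarefree : ∀ m .{{_ : NonZero m}} → ¬ PrimeSquareDivides m →
  μ m ≡ -1ℤ ℤ.^ length (factors (factorise m))
μ-squarefree m@(suc _) h rewrite dec-false (primeSquareDivides? m) h = refl

∤prime⇒coprime : ∀ {q k} → Prime q → q ∤ k → Coprime k q
∤prime⇒coprime q-prime q∤k (d∣k , d∣q) with prime⇒irreducible q-prime d∣q
... | inj₁ d≡1  = d≡1
... | inj₂ refl = contradiction d∣k q∤k

μ-prime-*-∣ : ∀ {q} → Prime q → ∀ k → q ∣ k → μ (k * q) ≡ 0ℤ
μ-prime-*-∣ {q} q-prime k q∣k = μ-nonsquarefree (k * q) (q , q-prime , *-monoˡ-∣ q q∣k)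

-- If a prime square divides `k`, both sides are 0. Otherwise `k * q` is squarefree too, and
-- adjoining `q` to the prime factors of `k` factorises it; by uniqueness of factorisation the
-- number of factors grows by exactly one.
μ-prime-*-∤ : ∀ {q} → Prime q → ∀ k → q ∤ k → μ (k * q) ≡ -1ℤ ℤ.* μ k
μ-prime-*-∤ {q} q-prime zero q∤0 = contradiction (q ∣0) q∤0
μ-prime-*-∤ {q} q-prime k@(suc _) q∤k with primeSquareDivides? k
... | yes h@(s , s-prime , s²∣k) =
  trans (μ-nonsquarefree (k * q) (s , s-prime , ∣m⇒∣m*n q s²∣k))
        (cong (λ x → -1ℤ ℤ.* x) (sym (μ-nonsquarefree k h)))
... | no squarefree = begin
  μ (k * q)                                    ≡⟨ μ-squarefree (k * q) squarefree′ ⟩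
  -1ℤ ℤ.^ length (factors (factorise (k * q))) ≡⟨ cong (-1ℤ ℤ.^_) (↭-length (factorisationUnique (factorise (k * q)) extended)) ⟩
  -1ℤ ℤ.* (-1ℤ ℤ.^ length (factors (factorise k)))
    ≡⟨ cong (λ x → -1ℤ ℤ.* x) (μ-squarefree k squarefree) ⟨
  -1ℤ ℤ.* μ k                                  ∎
  where
  instance
    q≢0 = prime⇒nonZero q-prime
    k*q≢0 = m*n≢0 k q

  extended : PrimeFactorisation (k * q)
  extended = record
    { factors         = q ∷ factors (factorise k)
    ; isFactorisation = trans (*-comm k q)
        (cong (q *_) (PrimeFactorisation.isFactorisation (factorise k)))
    ; factorsPrime    = q-prime ∷ PrimeFactorisation.factorsPrime (factorise k)
    }

  squarefree′ : ¬ PrimeSquareDivides (k * q)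
  -- For `s = q`, cancelling `q` would give `q ∣ k`. For any other prime `s`, the square is coprime
  -- to `q` and so would divide `k` itself.
  squarefree′ (s , s-prime , s²∣kq) with s ≟ q
  ... | yes refl = q∤k (*-cancelʳ-∣ q s²∣kq)
  ... | no s≢q   = squarefree (s , s-prime , coprime-divisor coprime (subst (s * s ∣_) (*-comm k q) s²∣kq))
    where
    q∤s : q ∤ s
    q∤s q∣s with prime⇒irreducible s-prime q∣s
    ... | inj₁ refl = ¬prime[1] q-prime
    ... | inj₂ q≡s  = s≢q (sym q≡s)

    coprime : Coprime (s * s) q
    coprime = ∤prime⇒coprime q-prime (λ q∣s² → [ q∤s , q∤s ]′ (euclidsLemma s s q-prime q∣s²))

∃-prime-divisor : ∀ d .{{_ : NonZero d}} → d ≢ 1 → ∃ λ q → Prime q × q ∣ d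
∃-prime-divisor d d≢1 with factorise d
... | record { factors = []     ; isFactorisation = eq } = contradiction eq d≢1
... | record { factors = q ∷ qs ; isFactorisation = eq ; factorsPrime = q-prime ∷ _ } =
  q , q-prime , subst (q ∣_) (sym eq) (m∣m*n (product qs))

∑μ-divisors-1 : ∀ n → ∑< (2 + n) (λ k → when (k ∣? 1) (μ k)) ≡ 1ℤ
-- The indices 0 and 1 evaluate to 0 and to `μ 1 = 1`; no larger index divides 1.
∑μ-divisors-1 n = cong (λ x → 0ℤ ℤ.+ (1ℤ ℤ.+ x))
  (∑<-zero n (λ i _ → when-false (2 + i ∣? 1) {μ (2 + i)} (>⇒∤ (s<s z<s))))

-- Splitting off a prime q ∣ d, the divisors q k cancel against the divisors k prime to q, and
-- those divisible by q² contribute nothing.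
∑μ-divisors : ∀ n d .{{_ : NonZero d}} → d < n → d ≢ 1 → ∑< n (λ k → when (k ∣? d) (μ k)) ≡ 0ℤ
∑μ-divisors n d d<n d≢1 with ∃-prime-divisor d d≢1
... | q , q-prime , divides e refl = begin
  ∑< n g
    -- Below `n * q` the multiples of `q` are exactly the `k * q` with `k < n`. The added terms are
    -- 0, because they lie beyond `d` and so do not divide it.
    ≡⟨ ∑<-extend n≤n*q g g-vanishes ⟨
  ∑< (n * q) g
    ≡⟨ ∑<-cong (n * q) (λ k _ → when-+-¬ (q ∣? k) (g k)) ⟩
  ∑< (n * q) (λ k → when (q ∣? k) (g k) ℤ.+ coprimePart k)
    ≡⟨ ∑<-distrib-+ (n * q) (λ k → when (q ∣? k) (g k)) coprimePart ⟩
  ∑< (n * q) (λ k → when (q ∣? k) (g k)) ℤ.+ ∑< (n * q) coprimePart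
    ≡⟨ cong₂ ℤ._+_ (∑<-multiples q n g) (∑<-extend n≤n*q coprimePart coprimePart-vanishes) ⟩
  ∑< n (λ k → g (k * q)) ℤ.+ ∑< n coprimePart
    ≡⟨ cong (ℤ._+ ∑< n coprimePart) (∑<-cong n (λ k _ → g-multiple k)) ⟩
  ∑< n (λ k → -1ℤ ℤ.* coprimePart k) ℤ.+ ∑< n coprimePart
    ≡⟨ cong (ℤ._+ ∑< n coprimePart) (*-distribˡ-∑< n -1ℤ coprimePart) ⟨
  -1ℤ ℤ.* ∑< n coprimePart ℤ.+ ∑< n coprimePart
    ≡⟨ cancel (∑< n coprimePart) ⟩
  0ℤ ∎
  where
  instance q≢0 = prime⇒nonZero q-prime

  g coprimePart : ℕ → ℤ
  g k = when (k ∣? e * q) (μ k)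
  coprimePart k = when (¬? (q ∣? k)) (g k)

  n≤n*q : n ≤ n * q
  n≤n*q = m≤m*n n q

  g-vanishes : ∀ k → n ≤ k → g k ≡ 0ℤ
  g-vanishes k n≤k = when-false (k ∣? e * q) (>⇒∤ (<-≤-trans d<n n≤k))

  coprimePart-vanishes : ∀ k → n ≤ k → coprimePart k ≡ 0ℤ
  coprimePart-vanishes k n≤k =
    trans (cong (when (¬? (q ∣? k))) (g-vanishes k n≤k)) (when-zero (¬? (q ∣? k)))

  g-multiple : ∀ k → g (k * q) ≡ -1ℤ ℤ.* coprimePart k
  g-multiple k with q ∣? k
  ... | yes q∣k = trans (cong (when (k * q ∣? e * q)) (μ-prime-*-∣ q-prime k q∣k)) (when-zero (k * q ∣? e * q))
  ... | no q∤k  = begin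
    when (k * q ∣? e * q) (μ (k * q))
      ≡⟨ cong (when (k * q ∣? e * q)) (μ-prime-*-∤ q-prime k q∤k) ⟩
    when (k * q ∣? e * q) (-1ℤ ℤ.* μ k)
      -- Both conditions amount to `k ∣ e`, because `k` is coprime to `q`.
      ≡⟨ when-cong (k * q ∣? e * q) (k ∣? e * q) _
           (λ h → ∣m⇒∣m*n q (*-cancelʳ-∣ {m = k} {n = e} q h))
           (λ h → *-monoˡ-∣ q (coprime-divisor (∤prime⇒coprime q-prime q∤k) (subst (k ∣_) (*-comm e q) h))) ⟩
    when (k ∣? e * q) (-1ℤ ℤ.* μ k)
      ≡⟨ when-negate (k ∣? e * q) (μ k) ⟩
    -1ℤ ℤ.* when (k ∣? e * q) (μ k) ∎
    where
    when-negate : (a? : Dec A) (x : ℤ) → when a? (-1ℤ ℤ.* x) ≡ -1ℤ ℤ.* when a? x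
    when-negate (yes _) x = refl
    when-negate (no  _) x = refl

  cancel : ∀ x → -1ℤ ℤ.* x ℤ.+ x ≡ 0ℤ
  cancel x = trans (cong (ℤ._+ x) (ℤ.-1*i≡-i x)) (ℤ.+-inverseˡ x)

-- Inserting a part into a weakly decreasing list.

≥-decTotalOrder : DecTotalOrder _ _ _
≥-decTotalOrder = Flip.decTotalOrder ≤-decTotalOrder

open DecTotalOrder ≥-decTotalOrder using () renaming (totalOrder to ≥-totalOrder)
open InsertionSort ≥-decTotalOrder using (insert; sort)
open InsertionSortProperties ≥-decTotalOrder using (insert-↭; insert-↗; sort-↭; sort-↗)

-- Sorted lists are determined by their entries up to order, so partitions need only be compared up
-- to permutation. The order is reversed because parts are listed decreasingly.
decreasing-↭⇒≡ : AllPairs _≥_ xs → AllPairs _≥_ ys → xs ↭ ys → xs ≡ ys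
decreasing-↭⇒≡ xs↘ ys↘ xs↭ys = Pointwise-≡⇒≡
  (Sorted.↗↭↗⇒≋ ≥-totalOrder (Sorted.AllPairs⇒Sorted ≥-totalOrder xs↘)
    (Sorted.AllPairs⇒Sorted ≥-totalOrder ys↘) (↭⇒↭ₛ xs↭ys))

insert-decreasing : ∀ k → AllPairs _≥_ xs → AllPairs _≥_ (insert k xs)
insert-decreasing k xs↘ =
  Sorted.Sorted⇒AllPairs ≥-totalOrder (insert-↗ k (Sorted.AllPairs⇒Sorted ≥-totalOrder xs↘))

insert-∷ : ∀ k y ys →
  (insert k (y ∷ ys) ≡ k ∷ y ∷ ys × y ≤ k) ⊎ (insert k (y ∷ ys) ≡ y ∷ insert k ys × k < y)
insert-∷ k y ys with y ≤? k
... | yes y≤k = inj₁ (cong (if_then k ∷ y ∷ ys else y ∷ insert k ys) (dec-true (y ≤? k) y≤k) , y≤k)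
... | no  y≰k = inj₂ (cong (if_then k ∷ y ∷ ys else y ∷ insert k ys) (dec-false (y ≤? k) y≰k) , ≰⇒> y≰k)

-- If `k` goes in front of one list but past the head of the other, the results differ in their
-- heads, since `k` is strictly smaller than an entry it passes. In the other cases the common head
-- is stripped. Injectivity on all lists, sorted or not, is what `Unique.map⁺` asks for.
insert-injective : ∀ k {xs ys} → insert k xs ≡ insert k ys → xs ≡ ys
insert-injective k {[]}     {[]}     eq = refl
insert-injective k {[]}     {y ∷ ys} eq with insert-∷ k y ys
... | inj₁ (eq₁ , _)   = case trans eq eq₁ of λ ()
... | inj₂ (eq₁ , k<y) = contradiction (∷-injectiveˡ (trans eq eq₁)) (<⇒≢ k<y)
insert-injective k {x ∷ xs} {[]}     eq with insert-∷ k x xs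
... | inj₁ (eq₁ , _)   = case trans (sym eq) eq₁ of λ ()
... | inj₂ (eq₁ , k<x) = contradiction (∷-injectiveˡ (trans (sym eq) eq₁)) (<⇒≢ k<x)
insert-injective k {x ∷ xs} {y ∷ ys} eq with insert-∷ k x xs | insert-∷ k y ys
... | inj₁ (eq₁ , _)   | inj₁ (eq₂ , _)   = ∷-injectiveʳ (trans (sym eq₁) (trans eq eq₂))
... | inj₁ (eq₁ , _)   | inj₂ (eq₂ , k<y) =
  contradiction (∷-injectiveˡ (trans (sym eq₁) (trans eq eq₂))) (<⇒≢ k<y)
... | inj₂ (eq₁ , k<x) | inj₁ (eq₂ , _)   =
  contradiction (∷-injectiveˡ (trans (sym eq₂) (trans (sym eq) eq₁))) (<⇒≢ k<x)
... | inj₂ (eq₁ , _)   | inj₂ (eq₂ , _)   with eq₃ ← trans (sym eq₁) (trans eq eq₂) =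
  cong₂ _∷_ (∷-injectiveˡ eq₃) (insert-injective k (∷-injectiveʳ eq₃))

-- Partitions with parts at least `r`.

partitions≥ : (r m : ℕ) → List (List ℕ)
partitions≥ r m = filter (all? (r ≤?_)) (partitions m)

∈-partitions≥ : ∀ r m → xs ∈ partitions≥ r m ⇔ (IsPartition m xs × All (r ≤_) xs)
∈-partitions≥ r m = mk⇔
  (λ xs∈ → let xs∈′ , r≤xs = ∈-filter⁻ (all? (r ≤?_)) xs∈ in to ∈-partitions xs∈′ , r≤xs)
  (λ (π , r≤xs) → ∈-filter⁺ (all? (r ≤?_)) (from ∈-partitions π) r≤xs)

partitions≥-unique : ∀ r m → Unique (partitions≥ r m)
partitions≥-unique r m = Unique.filter⁺ (all? (r ≤?_)) (partitions-unique m)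

-- Reduces each bijection between families of partitions to a comparison of members of two
-- duplicate-free lists.
unique∧set⇒↭ : {xs ys : List A} → Unique xs → Unique ys →
  (∀ {x} → x ∈ xs → x ∈ ys) → (∀ {x} → x ∈ ys → x ∈ xs) → xs ↭ ys
unique∧set⇒↭ xs! ys! ⊆ ⊇ = ∼bag⇒↭ (unique∧set⇒bag xs! ys! (mk⇔ ⊆ ⊇))

insert-isPartition : 1 ≤ k → IsPartition m xs → IsPartition (k + m) (insert k xs)
insert-isPartition {k = k} {xs = xs} 1≤k (isPartition xs↘ xs>0 refl) = isPartition
  (insert-decreasing k xs↘)
  (All-resp-↭ (↭-sym (insert-↭ k xs)) (1≤k ∷ xs>0))
  (sum-↭ (insert-↭ k xs))

∈-insert : ∀ k xs → k ∈ insert k xs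
∈-insert k xs = ∈-resp-↭ (↭-sym (insert-↭ k xs)) (here refl)

-- Cut out one occurrence of `k` and sort what is left, which makes it decreasing by construction.
-- Reinserting `k` gives a decreasing permutation of `xs`, hence `xs` itself.
remove-part : IsPartition (k + m) xs → k ∈ xs →
  ∃ λ ys → IsPartition m ys × insert k ys ≡ xs
remove-part {k = k} {m = m} (isPartition xs↘ xs>0 total) k∈xs with ∈-∃++ k∈xs
... | as , bs , refl = zs , isPartition zs↘ zs>0 zs-total , decreasing-↭⇒≡
      (insert-decreasing k zs↘) xs↘ (↭-trans (insert-↭ k zs) (↭-sym xs↭k∷zs))
  where
  zs : List ℕ
  zs = sort (as ++ bs)

  zs↘ : AllPairs _≥_ zs
  zs↘ = Sorted.Sorted⇒AllPairs ≥-totalOrder (sort-↗ (as ++ bs))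

  xs↭k∷zs : as ++ k ∷ bs ↭ k ∷ zs
  xs↭k∷zs = ↭-trans (shift k as bs) (prep k (↭-sym (sort-↭ (as ++ bs))))

  zs>0 : All (1 ≤_) zs
  zs>0 = All.tail (All-resp-↭ xs↭k∷zs xs>0)

  zs-total : sum zs ≡ m
  zs-total = +-cancelˡ-≡ k (sum zs) m (trans (sym (sum-↭ xs↭k∷zs)) total)

-- Partitions are separated by whether `k` occurs. Those containing `k` come from removing one `k`,
-- and reinserting it respects the lower bound because `r ≤ k`.
partitions≥-↭ : ∀ r m → 1 ≤ k → r ≤ k → partitions≥ r (k + m) ↭
  map (insert k) (partitions≥ r m) ++ filter (¬? ∘ (k ∈?_)) (partitions≥ r (k + m))
partitions≥-↭ {k} r m 1≤k r≤k = unique∧set⇒↭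
  (partitions≥-unique r (k + m))
  (Unique.++⁺ (Unique.map⁺ (insert-injective k) (partitions≥-unique r m))
              (Unique.filter⁺ (¬? ∘ (k ∈?_)) (partitions≥-unique r (k + m))) disjoint)
  ⊆ ⊇
  where
  inserted = map (insert k) (partitions≥ r m)
  k-free   = filter (¬? ∘ (k ∈?_)) (partitions≥ r (k + m))

  disjoint : ∀ {xs} → ¬ (xs ∈ inserted × xs ∈ k-free)
  disjoint (xs∈ , xs∈′) with ∈-map⁻ (insert k) xs∈
  ... | ys , _ , refl =
    proj₂ (∈-filter⁻ (¬? ∘ (k ∈?_)) {xs = partitions≥ r (k + m)} xs∈′) (∈-insert k ys)

  ⊆ : ∀ {xs} → xs ∈ partitions≥ r (k + m) → xs ∈ inserted ++ k-free
  ⊆ {xs} xs∈ with k ∈? xs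
  ... | no k∉xs  = ∈-++⁺ʳ inserted (∈-filter⁺ (¬? ∘ (k ∈?_)) xs∈ k∉xs)
  ... | yes k∈xs with π , r≤xs ← to (∈-partitions≥ r (k + m)) xs∈ with remove-part π k∈xs
  ...   | ys , π′ , refl = ∈-++⁺ˡ (∈-map⁺ (insert k)
            (from (∈-partitions≥ r m) (π′ , All.tail (All-resp-↭ (insert-↭ k ys) r≤xs))))

  ⊇ : ∀ {xs} → xs ∈ inserted ++ k-free → xs ∈ partitions≥ r (k + m)
  ⊇ xs∈ with ∈-++⁻ inserted xs∈
  ... | inj₂ xs∈′ = proj₁ (∈-filter⁻ (¬? ∘ (k ∈?_)) xs∈′)
  ... | inj₁ xs∈′ with ∈-map⁻ (insert k) xs∈′
  ...   | ys , ys∈ , refl with π , r≤ys ← to (∈-partitions≥ r m) ys∈ = from (∈-partitions≥ r (k + m))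
            (insert-isPartition 1≤k π , All-resp-↭ (↭-sym (insert-↭ k ys)) (r≤k ∷ r≤ys))

-- Counting partitions and occurrences of a part.

p≥ : (r m : ℕ) → ℕ
p≥ r m = length (partitions≥ r m)

multiplicity-insert : ∀ k xs → multiplicity k (insert k xs) ≡ suc (multiplicity k xs)
multiplicity-insert k xs = trans (↭-length (filter-↭ (k ≟_) (insert-↭ k xs)))
  (cong length (filter-accept (k ≟_) {xs = xs} refl))

∉⇒multiplicity≡0 : k ∉ xs → multiplicity k xs ≡ 0
∉⇒multiplicity≡0 {k = k} k∉xs = cong length (filter-none (k ≟_) (¬Any⇒All¬ _ k∉xs))

sum-map-zero : (f : A → ℕ) (xs : List A) → (∀ {x} → x ∈ xs → f x ≡ 0) → sum (map f xs) ≡ 0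
sum-map-zero f []       h = refl
sum-map-zero f (x ∷ xs) h = cong₂ _+_ (h (here refl)) (sum-map-zero f xs (h ∘ there))

sum-map-suc : (f : A → ℕ) (xs : List A) → sum (map (suc ∘ f) xs) ≡ length xs + sum (map f xs)
sum-map-suc f []       = refl
sum-map-suc f (x ∷ xs) = cong suc (begin
  f x + sum (map (suc ∘ f) xs)       ≡⟨ cong (f x +_) (sum-map-suc f xs) ⟩
  f x + (length xs + sum (map f xs)) ≡⟨ x∙yz≈y∙xz +-commutativeSemigroup (f x) (length xs) (sum (map f xs)) ⟩
  length xs + (f x + sum (map f xs)) ∎)

-- Only partitions containing `k` count. Removing one `k` from each accounts for one occurrence per
-- partition of `m`, and the occurrences left over are those counted by `S r m k`.
S-+ : ∀ r m → 1 ≤ k → r ≤ k → S r (k + m) k ≡ p≥ r m + S r m k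
S-+ {k} r m 1≤k r≤k = begin
  S r (k + m) k
    -- `S` unfolds to a sum over `partitions≥`, so the splitting applies directly.
    ≡⟨ sum-↭ (map⁺ (multiplicity k) (partitions≥-↭ r m 1≤k r≤k)) ⟩
  sum (map (multiplicity k) (map (insert k) (partitions≥ r m) ++ k-free))
    ≡⟨ cong sum (map-++ (multiplicity k) (map (insert k) (partitions≥ r m)) k-free) ⟩
  sum (map (multiplicity k) (map (insert k) (partitions≥ r m)) ++ map (multiplicity k) k-free)
    ≡⟨ sum-++ (map (multiplicity k) (map (insert k) (partitions≥ r m))) _ ⟩
  sum (map (multiplicity k) (map (insert k) (partitions≥ r m))) + sum (map (multiplicity k) k-free)
    ≡⟨ cong₂ _+_
         (cong sum (trans (sym (map-∘ (partitions≥ r m))) (map-cong (multiplicity-insert k) (partitions≥ r m))))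
         (sum-map-zero (multiplicity k) k-free
           (λ xs∈ → ∉⇒multiplicity≡0 (proj₂ (∈-filter⁻ (¬? ∘ (k ∈?_)) {xs = partitions≥ r (k + m)} xs∈)))) ⟩
  sum (map (suc ∘ multiplicity k) (partitions≥ r m)) + 0
    ≡⟨ +-identityʳ _ ⟩
  sum (map (suc ∘ multiplicity k) (partitions≥ r m))
    ≡⟨ sum-map-suc (multiplicity k) (partitions≥ r m) ⟩
  p≥ r m + S r m k ∎
  where
  k-free = filter (¬? ∘ (k ∈?_)) (partitions≥ r (k + m))

S-zero : ∀ r m k → k < r ⊎ m < k → S r m k ≡ 0
S-zero r m k h = sum-map-zero (multiplicity k) (partitions≥ r m) (λ xs∈ → ∉⇒multiplicity≡0 (k∉ h xs∈))
  where
  k∉ : k < r ⊎ m < k → xs ∈ partitions≥ r m → k ∉ xs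
  k∉ h xs∈ k∈ with isPartition _ _ total , r≤xs ← to (∈-partitions≥ r m) xs∈ =
    [ (λ k<r → <⇒≱ k<r (All.lookup r≤xs k∈))
    , (λ m<k → <⇒≱ m<k (subst (k ≤_) total (All.lookup (all≤sum _) k∈)))
    ]′ h

p≥1≡p : ∀ n → p≥ 1 n ≡ p n
p≥1≡p n = cong length (filter-all (all? (1 ≤?_)) {xs = partitions n}
  (All.tabulate (IsPartition.positive ∘ to (∈-partitions {n}))))

partitions≥-suc : ∀ r m → filter (¬? ∘ (r ∈?_)) (partitions≥ r m) ↭ partitions≥ (suc r) m
partitions≥-suc r m = unique∧set⇒↭
  (Unique.filter⁺ (¬? ∘ (r ∈?_)) (partitions≥-unique r m)) (partitions≥-unique (suc r) m)
  ⊆ ⊇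
  where
  ⊆ : ∀ {xs} → xs ∈ filter (¬? ∘ (r ∈?_)) (partitions≥ r m) → xs ∈ partitions≥ (suc r) m
  ⊆ xs∈ with xs∈′ , r∉xs ← ∈-filter⁻ (¬? ∘ (r ∈?_)) {xs = partitions≥ r m} xs∈
        with π , r≤xs ← to (∈-partitions≥ r m) xs∈′ =
    from (∈-partitions≥ (suc r) m) (π , All.tabulate λ x∈ → ≤∧≢⇒< (All.lookup r≤xs x∈) λ { refl → r∉xs x∈ })

  ⊇ : ∀ {xs} → xs ∈ partitions≥ (suc r) m → xs ∈ filter (¬? ∘ (r ∈?_)) (partitions≥ r m)
  ⊇ xs∈ with π , r<xs ← to (∈-partitions≥ (suc r) m) xs∈ = ∈-filter⁺ (¬? ∘ (r ∈?_))
    (from (∈-partitions≥ r m) (π , All.map <⇒≤ r<xs)) (λ r∈ → <-irrefl refl (All.lookup r<xs r∈))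

-- Partitions containing a 1 correspond to those of `n` by removing it; the others have all parts at
-- least 2.
p-suc : ∀ n → p (suc n) ≡ p≥ 2 (suc n) + p n
p-suc n = begin
  p (suc n)                                    ≡⟨ p≥1≡p (suc n) ⟨
  p≥ 1 (suc n)                                 ≡⟨ ↭-length (partitions≥-↭ 1 n ≤-refl ≤-refl) ⟩
  length (map (insert 1) (partitions≥ 1 n) ++ 1-free)
    ≡⟨ length-++ (map (insert 1) (partitions≥ 1 n)) ⟩
  length (map (insert 1) (partitions≥ 1 n)) + length 1-free
    ≡⟨ cong₂ _+_ (trans (length-map (insert 1) (partitions≥ 1 n)) (p≥1≡p n)) (↭-length (partitions≥-suc 1 (suc n))) ⟩
  p n + p≥ 2 (suc n)
    ≡⟨ +-comm (p n) _ ⟩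
  p≥ 2 (suc n) + p n ∎
  where
  1-free = filter (¬? ∘ (1 ∈?_)) (partitions≥ 1 (suc n))

-- Occurrences as sums over multiples, and Möbius inversion.

∑p≥ : (r m k : ℕ) → ℤ
∑p≥ r m k = ∑< m (λ i → when (k ∣? suc i) (ℤ.+ p≥ r (m ∸ suc i)))

-- This is the recurrence of `S-+`. With `d = suc i`, the first multiple `d = k` sits at the last of
-- the first `k` indices and gives `p≥ r m`; subtracting `k` from the later multiples leaves the sum
-- for `m`.
∑p≥-+ : ∀ r m k .{{_ : NonZero k}} →
  ∑p≥ r (k + m) k ≡ ℤ.+ p≥ r m ℤ.+ ∑p≥ r m k
∑p≥-+ r m k@(suc k-1) = begin
  ∑< (k + m) f
    ≡⟨ ∑<-split k m f ⟩
  ∑< k f ℤ.+ ∑< m (λ i → f (k + i))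
    ≡⟨ cong₂ ℤ._+_
         (trans (∑<-last k-1 f (λ i i<k-1 → when-false (k ∣? suc i) (>⇒∤ (s<s i<k-1))))
         (trans (when-true (k ∣? k) ∣-refl) (cong (λ l → ℤ.+ p≥ r l) (m+n∸m≡n k m))))
         (∑<-cong m (λ i _ → shifted i)) ⟩
  ℤ.+ p≥ r m ℤ.+ ∑p≥ r m k ∎
  where
  f : ℕ → ℤ
  f i = when (k ∣? suc i) (ℤ.+ p≥ r (k + m ∸ suc i))

  shifted : ∀ i → f (k + i) ≡ when (k ∣? suc i) (ℤ.+ p≥ r (m ∸ suc i))
  shifted i = begin
    f (k + i)
      ≡⟨ cong (λ l → when (k ∣? l) (ℤ.+ p≥ r (k + m ∸ l))) (+-suc k i) ⟨
    when (k ∣? k + suc i) (ℤ.+ p≥ r (k + m ∸ (k + suc i)))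
      ≡⟨ cong (λ l → when (k ∣? k + suc i) (ℤ.+ p≥ r l)) ([m+n]∸[m+o]≡n∸o k m (suc i)) ⟩
    when (k ∣? k + suc i) (ℤ.+ p≥ r (m ∸ suc i))
      ≡⟨ when-cong (k ∣? k + suc i) (k ∣? suc i) _ (λ h → ∣m+n∣m⇒∣n h ∣-refl) (∣m∣n⇒∣m+n ∣-refl) ⟩
    when (k ∣? suc i) (ℤ.+ p≥ r (m ∸ suc i)) ∎

-- Both sides satisfy the same recurrence in steps of `k`, and both vanish when `m < k`.
S≡∑p≥ : ∀ r k .{{_ : NonZero k}} → r ≤ k → ∀ m → ℤ.+ S r m k ≡ ∑p≥ r m k
S≡∑p≥ r k r≤k = <-rec _ step
  where
  step : ∀ m → (∀ {l} → l < m → ℤ.+ S r l k ≡ ∑p≥ r l k) → ℤ.+ S r m k ≡ ∑p≥ r m k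
  step m rec with m <? k
  ... | yes m<k = trans (cong ℤ.+_ (S-zero r m k (inj₂ m<k)))
    (sym (∑<-zero m (λ i i<m → when-false (k ∣? suc i) (>⇒∤ (≤-<-trans i<m m<k)))))
  ... | no m≮k = begin
    ℤ.+ S r m k
      ≡⟨ cong (λ l → ℤ.+ S r l k) (m+[n∸m]≡n k≤m) ⟨
    ℤ.+ S r (k + (m ∸ k)) k
      ≡⟨ cong ℤ.+_ (S-+ r (m ∸ k) (>-nonZero⁻¹ k) r≤k) ⟩
    ℤ.+ p≥ r (m ∸ k) ℤ.+ ℤ.+ S r (m ∸ k) k
      ≡⟨ +-congˡ (ℤ.+ p≥ r (m ∸ k)) (rec m∸k<m) ⟩
    ℤ.+ p≥ r (m ∸ k) ℤ.+ ∑p≥ r (m ∸ k) k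
      ≡⟨ ∑p≥-+ r (m ∸ k) k ⟨
    ∑p≥ r (k + (m ∸ k)) k
      ≡⟨ cong (λ l → ∑p≥ r l k) (m+[n∸m]≡n k≤m) ⟩
    ∑p≥ r m k ∎
    where
    k≤m : k ≤ m
    k≤m = ≮⇒≥ m≮k

    m∸k<m : m ∸ k < m
    m∸k<m = ∸-monoʳ-< (>-nonZero⁻¹ k) k≤m

-- Exchanging the sums gives `f i` the sum of `μ` over the divisors of `suc i` as its coefficient.
-- The bound `2 + n` exceeds every `suc i` that occurs, so no divisor is cut off.
∑μ-inversion : ∀ n (f : ℕ → ℤ) →
  ∑< (2 + n) (λ k → ∑< (suc n) (λ i → when (k ∣? suc i) (f i)) ℤ.* μ k) ≡ f 0
∑μ-inversion n f = begin
  ∑< (2 + n) (λ k → ∑< (suc n) (λ i → when (k ∣? suc i) (f i)) ℤ.* μ k)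
    ≡⟨ ∑<-cong (2 + n) (λ k _ → trans
         (*-distribʳ-∑< (suc n) (μ k) (λ i → when (k ∣? suc i) (f i)))
         (∑<-cong (suc n) (λ i _ → when-* (k ∣? suc i) (f i) (μ k)))) ⟩
  ∑< (2 + n) (λ k → ∑< (suc n) (λ i → f i ℤ.* when (k ∣? suc i) (μ k)))
    ≡⟨ ∑<-comm (2 + n) (suc n) (λ k i → f i ℤ.* when (k ∣? suc i) (μ k)) ⟩
  ∑< (suc n) (λ i → ∑< (2 + n) (λ k → f i ℤ.* when (k ∣? suc i) (μ k)))
    ≡⟨ ∑<-cong (suc n) (λ i _ → *-distribˡ-∑< (2 + n) (f i) (λ k → when (k ∣? suc i) (μ k))) ⟨
  ∑< (suc n) g
    ≡⟨ ∑<-head n g (λ i i<n → trans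
         (cong (λ x → f (suc i) ℤ.* x) (∑μ-divisors (2 + n) (2 + i) (s<s (s<s i<n)) (λ ())))
         (ℤ.*-zeroʳ (f (suc i)))) ⟩
  g 0
    ≡⟨ cong (λ x → f 0 ℤ.* x) (∑μ-divisors-1 n) ⟩
  f 0 ℤ.* 1ℤ
    ≡⟨ ℤ.*-identityʳ (f 0) ⟩
  f 0 ∎
  where
  g : ℕ → ℤ
  g i = f i ℤ.* ∑< (2 + n) (λ k → when (k ∣? suc i) (μ k))

-- Iterating `p-suc` classifies the partitions of `n` by the number `i` of their ones.
p≡∑p≥2 : ∀ n → ℤ.+ p n ≡ ∑< (suc n) (λ i → ℤ.+ p≥ 2 (n ∸ i))
p≡∑p≥2 zero    = refl
p≡∑p≥2 (suc n) = trans (cong ℤ.+_ (p-suc n)) (+-congˡ (ℤ.+ p≥ 2 (suc n)) (p≡∑p≥2 n))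

-- The cases `r = 1` and `r = 2`.

∑Sμ-1 : ∀ n → ∑< (suc n) (λ i → ℤ.+ S 1 (suc n) (suc i) ℤ.* μ (suc i)) ≡ ℤ.+ p n
∑Sμ-1 n = begin
  ∑< (suc n) (λ i → ℤ.+ S 1 (suc n) (suc i) ℤ.* μ (suc i))
    ≡⟨ ∑<-cong (suc n) (λ i _ → cong (ℤ._* μ (suc i)) (S≡∑p≥ 1 (suc i) (s≤s z≤n) (suc n))) ⟩
  ∑< (suc n) (λ i → t (suc i))
    -- The inversion sums from index 0, which can be adjoined because `μ 0` is 0 by convention.
    ≡⟨ ℤ.+-identityˡ _ ⟨
  0ℤ ℤ.+ ∑< (suc n) (λ i → t (suc i))
    ≡⟨ cong (ℤ._+ ∑< (suc n) (λ i → t (suc i))) (ℤ.*-zeroʳ (∑p≥ 1 (suc n) 0)) ⟨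
  ∑< (2 + n) t
    ≡⟨ ∑μ-inversion n (λ i → ℤ.+ p≥ 1 (n ∸ i)) ⟩
  ℤ.+ p≥ 1 n
    ≡⟨ cong ℤ.+_ (p≥1≡p n) ⟩
  ℤ.+ p n ∎
  where
  t : ℕ → ℤ
  t k = ∑p≥ 1 (suc n) k ℤ.* μ k

∑Sμ-2 : ∀ n → ∑< (suc n) (λ i → ℤ.+ S 2 (2 + n) (2 + i) ℤ.* μ (2 + i)) ≡ ℤ.- (ℤ.+ p n)
∑Sμ-2 n = begin
  ∑< (suc n) (λ i → ℤ.+ S 2 (2 + n) (2 + i) ℤ.* μ (2 + i))
    ≡⟨ ∑<-cong (suc n) (λ i _ → cong (ℤ._* μ (2 + i)) (S≡∑p≥ 2 (2 + i) (s≤s (s≤s z≤n)) (2 + n))) ⟩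
  s
    ≡⟨ cancel (ℤ.+ p≥ 2 (suc n)) (ℤ.+ p n) s total ⟩
  ℤ.- (ℤ.+ p n) ∎
  where
  t : ℕ → ℤ
  t k = ∑p≥ 2 (2 + n) k ℤ.* μ k

  s : ℤ
  s = ∑< (suc n) (λ i → t (2 + i))

  -- Every `d` is a multiple of 1 and `μ 1` evaluates to 1, so this term is the complete sum in
  -- `p≡∑p≥2`.
  t[1] : t 1 ≡ ℤ.+ p≥ 2 (suc n) ℤ.+ ℤ.+ p n
  t[1] = begin
    ∑p≥ 2 (2 + n) 1 ℤ.* 1ℤ
      ≡⟨ ℤ.*-identityʳ _ ⟩
    ∑p≥ 2 (2 + n) 1
      ≡⟨ ∑<-cong (2 + n) {g = λ i → ℤ.+ p≥ 2 (suc n ∸ i)} (λ i _ → when-true (1 ∣? suc i) (1∣ suc i)) ⟩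
    ∑< (2 + n) (λ i → ℤ.+ p≥ 2 (suc n ∸ i))
      ≡⟨ p≡∑p≥2 (suc n) ⟨
    ℤ.+ p (suc n)
      ≡⟨ cong ℤ.+_ (p-suc n) ⟩
    ℤ.+ p≥ 2 (suc n) ℤ.+ ℤ.+ p n ∎

  total : ℤ.+ p≥ 2 (suc n) ≡ (ℤ.+ p≥ 2 (suc n) ℤ.+ ℤ.+ p n) ℤ.+ s
  total = begin
    ℤ.+ p≥ 2 (suc n)
      -- The inversion covers all indices from 0; those at 0 and 1 are split off, leaving the wanted
      -- sum `s`. The left side then cancels against the first summand of `t 1`.
      ≡⟨ ∑μ-inversion (suc n) (λ i → ℤ.+ p≥ 2 (suc n ∸ i)) ⟨
    t 0 ℤ.+ (t 1 ℤ.+ s)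
      ≡⟨ cong (ℤ._+ (t 1 ℤ.+ s)) (ℤ.*-zeroʳ (∑p≥ 2 (2 + n) 0)) ⟩
    0ℤ ℤ.+ (t 1 ℤ.+ s)
      ≡⟨ ℤ.+-identityˡ _ ⟩
    t 1 ℤ.+ s
      ≡⟨ cong (ℤ._+ s) t[1] ⟩
    (ℤ.+ p≥ 2 (suc n) ℤ.+ ℤ.+ p n) ℤ.+ s ∎

  cancel : ∀ a b c → a ≡ (a ℤ.+ b) ℤ.+ c → c ≡ ℤ.- b
  cancel a b c a≡a+b+c = inverseʳ-unique b c (identityʳ-unique a (b ℤ.+ c)
    (trans (sym (ℤ.+-assoc a b c)) (sym a≡a+b+c)))

theorem1p1 : ∀ (n r : ℕ) → r ≡ 1 ⊎ r ≡ 2 →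
  ℤ.+ p n ≡ -1ℤ ℤ.^ (r ∸ 1) ℤ.* (∑[ k from r to n + r ] (ℤ.+ S r (n + r) k ℤ.* μ k))
-- With `n + r` turned into `r + n`, the length of the range computes to `suc n` in both cases.
theorem1p1 n _ (inj₁ refl) rewrite +-comm n 1 =
  sym (trans (ℤ.*-identityˡ _) (∑Sμ-1 n))
theorem1p1 n _ (inj₂ refl) rewrite +-comm n 2 = begin
  ℤ.+ p n                                ≡⟨ ℤ.neg-involutive (ℤ.+ p n) ⟨
  ℤ.- (ℤ.- (ℤ.+ p n))                    ≡⟨ ℤ.-1*i≡-i (ℤ.- (ℤ.+ p n)) ⟨
  -1ℤ ℤ.* (ℤ.- (ℤ.+ p n))                ≡⟨ cong (λ x → -1ℤ ℤ.* x) (∑Sμ-2 n) ⟨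
  -1ℤ ℤ.* ∑< (suc n) (λ i → ℤ.+ S 2 (2 + n) (2 + i) ℤ.* μ (2 + i)) ∎
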